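{- Let $S=(M_{\mathsf A})_{\mathsf A\in\mathcal P}$ be a system of (deterministic) reversible CFSMs. If $S'$ is a system of standard CFSMs such that $S'=\mathsf{forget}(S)$, then for all $\langle\sigma,\chi\rangle\in\mathsf{RC}_{S'}$ there is a configuration $\langle\sigma',\chi',\beta'\rangle\in\mathsf{RC}_S$ such that $\mathsf{forget}(\langle\sigma',\chi',\beta'\rangle)=\langle\sigma,\chi\rangle$.
   Context: **Basic sets.** $\mathcal P$ is a finite set of participants, $\mathcal M$ a set of messages containing two distinguished messages $\dagger,\ddagger$ (start / end of loop), $\mathbb Z_0$ the nonzero integers (control points). These three sets are pairwise disjoint. Channels: $\mathcal C=\{(\mathsf A,\mathsf B)\in\mathcal P\times\mathcal P\mid \mathsf A\ne\mathsf B\}$, and $(\mathsf A,\mathsf B)$ is written $\mathsf A\cdot\mathsf B$. Events: $\mathcal E=\mathcal E^!\cup\mathcal E^?$ with $\mathcal E^!=\mathcal C\times\{!\}\times\mathbb Z_0\times\mathcal M$ (outputs, written $\mathsf A\cdot\mathsf B!^i m$) and $\mathcal E^?=\mathcal C\times\{?\}\times\mathbb Z_0\times\mathcal M$ (inputs, written $\mathsf A\cdot\mathsf B?^i m$). The subject is $\mathsf{sbj}(\mathsf A\cdot\mathsf B!^i m)=\mathsf A$ and $\mathsf{sbj}(\mathsf A\cdot\mathsf B?^i m)=\mathsf B$. $\Phi$ is the set of guards generated by $\phi::=p(\mathsf A_1\cdot\mathsf B_1,\dots,\mathsf A_N\cdot\mathsf B_N)\mid m\in\mathsf A\cdot\mathsf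 B\mid\neg\phi\mid\phi\vee\phi$, with $p$ from an unspecified set of predicate symbols. **Reversible CFSMs.** For a set $Q$ put $L_Q=Q\times\mathcal E\times\Phi$ and let $\overline{L_Q}=\{\overline l\mid l\in L_Q\}$ be a disjoint marked copy. Let $\mathbf 1$ be a distinguished symbol. For $\lambda=(q,e,\phi)$ or $\lambda=\overline{(q,e,\phi)}$ write $\lambda_Q=q$, $\lambda_{\mathcal E}=e$, $\lambda_\Phi=\phi$. A reversible CFSM (r-CFSM) for $\mathsf A\in\mathcal P$ is a finite transition system $M=(Q,q_0,\to)$ with $q_0\in Q$ and $\to\,\subseteq Q\times\mathcal E\times(\{\mathbf 1\}\cup L_Q\cup\overline{L_Q})\times Q$ such that for every $(q,e,\lambda,q')\in\,\to$: $\mathsf{sbj}(e)=\mathsf A$ and, if $\lambda\neq\mathbf 1$, the guard $\lambda_\Phi$ predicates only on channels of $\mathsf A$. Write $q\xrightarrow[\lambda]{e}q'$ for $(q,e,\lambda,q')\in\,\to$. A system $S=(M_{\mathsf A})_{\mathsf A\in\mathcal P}$ assigns to each $\mathsf A\in\mathcal P$ an r-CFSM $M_{\mathsf A}=(Q_{\mathsf A},q_{0\mathsf A},\to_{\mathsf A})$ for $\mathsf A$. Only deterministic machines are considered, the sets $Q_{\mathsf A}$ are pairwise disjoint, and $\mathcal Q_S=\bigcup_{\mathsf A}Q_{\mathsf A}$. **Configurations.** $\mathsf{Log}=\mathcal M\times\mathcal Q_S\times\mathbb Z_0\times\mathbb N$. A log $(m,q,i,t)$ records a message $m$, the sender's state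 $q$ when sending, the control point $i$, and a time-stamp $t$. A channel content is a pair in $\mathsf{Log}^\star\times\mathsf{Log}^\star$, written $\ell_1,\dots,\ell_{p-1}\,;\,\ell_p,\dots,\ell_h$, with strictly increasing time-stamps along $\ell_1,\dots,\ell_h$. The left part is the already consumed logs (history), the right part the pending ones. A configuration is $\langle\sigma,\chi,\beta\rangle$ with $\sigma:\mathcal P\to\mathcal Q_S$, $\sigma(\mathsf A)\in Q_{\mathsf A}$; $\chi:\mathcal C\to\mathsf{Log}^\star\times\mathsf{Log}^\star$; $\beta:\mathcal Q_S\to 2^{\mathcal E\times\Phi}\times\{\mathtt{tt},\mathtt{ff}\}$. The initial configuration $\langle\sigma_0,\chi_0,\beta_0\rangle$ has $\sigma_0(\mathsf A)=q_{0\mathsf A}$, $\chi_0(\mathsf A\cdot\mathsf B)=(\varepsilon\,;\,\varepsilon)$, $\beta_0(q)=(\emptyset,\mathtt{ff})$. **Forward semantics.** When $\beta(q)=(X,b)$, "$z\in\beta(q)$" means $z\in X$. A decoration $\lambda$ is valid for $\beta$ if $\lambda=\mathbf 1$, or $(\lambda_{\mathcal E},\lambda_\Phi)\in\beta(\lambda_Q)$ implies that the boolean component of $\beta(\lambda_Q)$ is $\mathtt{tt}$. The partial map $\mathrm{upd}_O(\lambda,\beta)$ equals $\beta$ if $\lambda=\mathbf 1$ or ($\lambda\in L_Q$ and $\lambda$ is valid for $\beta$); equals $\beta[\lambda_Q\mapsto(\emptyset,\mathtt{ff})]$ if $\lambda\in\overline{L_Q}$ and $\lambda$ is valid for $\beta$;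 and is undefined otherwise. The total map $\mathrm{upd}_I(\lambda,\beta)$ equals $\beta$ if $\lambda\notin\overline{L_Q}$ and $\beta[\lambda_Q\mapsto(\emptyset,\mathtt{ff})]$ if $\lambda\in\overline{L_Q}$. The relation $\Longrightarrow$ is the smallest one closed under: - [out] if $\sigma(\mathsf A)\xrightarrow[\lambda]{\mathsf A\cdot\mathsf B!^i m}q$ in $M_{\mathsf A}$ and $\mathrm{upd}_O(\lambda,\beta)$ is defined, then $\langle\sigma,\chi,\beta\rangle\Longrightarrow\langle\sigma[\mathsf A\mapsto q],\chi[\mathsf A\cdot\mathsf B\mapsto\chi(\mathsf A\cdot\mathsf B).\ell],\mathrm{upd}_O(\lambda,\beta)\rangle$, where $\ell=(m,\sigma(\mathsf A),i,t)$ is appended at the end of the pending part and $t=1+\max\{t'\mid(\_,\_,\_,t')\in\chi(\mathsf A\cdot\mathsf C),\ \mathsf C\in\mathcal P\setminus\{\mathsf A\}\}$ ($\max\emptyset=0$; logs in both parts of the channels count). - [inp] if $\sigma(\mathsf A)\xrightarrow[\lambda]{\mathsf B\cdot\mathsf A?^i m}q$ in $M_{\mathsf A}$, $\chi(\mathsf B\cdot\mathsf A)=\ell_1,\dots,\ell_{p-1}\,;\,\ell_p,\dots,\ell_h$ and the message component of $\ell_p$ is $m$, then $\langle\sigma,\chi,\beta\rangle\Longrightarrow\langle\sigma[\mathsf A\mapsto q],\chi[\mathsf B\cdot\mathsf A\mapsto\ell_1,\dots,\ell_p\,;\,\ell_{p+1},\dots,\ell_h],\mathrm{upd}_I(\lambda,\beta)\rangle$.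 $\mathsf{RC}_S$ is the set of configurations reachable from the initial one by the reflexive-transitive closure of $\Longrightarrow$. **Standard CFSMs and forget.** A standard CFSM is $(Q,q_0,\to)$ with $\to\,\subseteq Q\times\mathcal E\times Q$. Configurations of a standard system are pairs $\langle\sigma,\chi\rangle$ with $\sigma$ a map assigning to each participant $\mathsf A\in\mathcal P$ a state $\sigma(\mathsf A)$ of the machine of $\mathsf A$ in that system, and $\chi:\mathcal C\to\mathcal M^\star$; initially all machines are in their initial state and all channels are empty. A transition $\sigma(\mathsf A)\xrightarrow{\mathsf A\cdot\mathsf B!^i m}q$ moves $\mathsf A$ to $q$ and appends $m$ to $\chi(\mathsf A\cdot\mathsf B)$. A transition $\sigma(\mathsf A)\xrightarrow{\mathsf B\cdot\mathsf A?^i m}q$ is enabled when $m$ is the first element of $\chi(\mathsf B\cdot\mathsf A)$, moves $\mathsf A$ to $q$ and removes that $m$. $\mathsf{RC}_{S'}$ is the set of configurations of the standard system $S'$ reachable from its initial one. For an r-CFSM $M=(Q,q_0,\to)$, $\mathsf{forget}(M)=(Q,q_0,\{(q,e,q')\mid(q,e,\lambda,q')\in\,\to\})$, and $\mathsf{forget}(S):\mathsf A\mapsto\mathsf{forget}(S(\mathsf A))$. On logs $\mathsf{forget}(m,q,i,t)=m$, extended pointwise to sequences. On configurations $\mathsf{forget}(\langle\sigma,\chi,\beta\rangle)=\langle\sigma,\chi'\rangle$ with $\chi'(\mathsf A\cdot\mathsf B)=\mathsf{forget}(\ell_1),\dots,\mathsf{forget}(\ell_n)$ when $\chi(\mathsf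 A\cdot\mathsf B)=(\_\,;\,\ell_1,\dots,\ell_n)$, so only pending messages are kept. -}

module Defs where

open import Level using (0ℓ)
open import Data.Bool.Base using (Bool; true; false)
open import Data.Empty using (⊥-elim-irr)
open import Data.Fin.Base using (Fin)
open import Data.Fin.Properties using (inj⇒≟)
open import Data.Integer.Base using (ℤ; NonZero)
open import Data.List.Base
  using (List; []; _∷_; [_]; _++_; map; mapMaybe; concatMap; allFin)
open import Data.List.Extrema.Nat using (max; xs≤max)
open import Data.List.Membership.Propositional using (_∈_)
open import Data.List.Membership.Propositional.Properties
  using (∈-map⁺; ∈-allFin; ∈-concatMap⁺)
open import Data.List.Properties using (++-assoc)
open import Data.List.Relation.Binary.BagAndSetEquality using (_∼[_]_; set)
import Data.List.Relation.Unary.All as All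
open All using (All; []; _∷_)
open import Data.List.Relation.Unary.AllPairs using (AllPairs; []; _∷_)
import Data.List.Relation.Unary.AllPairs.Properties as AllPairs
open import Data.List.Relation.Unary.Any as Any using (here; there)
open import Data.Maybe.Base using (Maybe; just; nothing)
open import Data.Nat.Base using (ℕ; suc; _<_; s≤s)
open import Data.Product.Base using (Σ; _×_; _,_; proj₁; proj₂)
open import Data.Product.Properties using (≡-dec)
open import Data.Refinement using (Refinement)
open import Data.Sum.Base using (_⊎_)
open import Data.Unit.Base using (⊤)
open import Function.Base using (_∘_)
open import Function.Bundles using (_↔_; module Inverse)
open import Function.Properties.Inverse using (↔⇒↣)
open import Relation.Binary.Construct.Closure.ReflexiveTransitive using (Star)
open import Relation.Binary.Definitions using (DecidableEquality)
open import Relation.Binary.PropositionalEquality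
  using (_≡_; _≢_; refl; sym; subst)
open import Relation.Nullary using (yes; no)
open import Relation.Nullary.Decidable using (map′; _×-dec_)
open import Relation.Unary using (Pred; ∅)

record FiniteSet : Set₁ where
  field
    Carrier     : Set
    size        : ℕ
    enumeration : Carrier ↔ Fin size

  _≟_ : DecidableEquality Carrier
  _≟_ = inj⇒≟ (↔⇒↣ enumeration)

  elements : List Carrier
  elements = map (Inverse.from enumeration) (allFin size)

  ∈-elements : ∀ x → x ∈ elements
  ∈-elements x =
    subst (_∈ elements) (Inverse.strictlyInverseʳ enumeration x)
      (∈-map⁺ (Inverse.from enumeration) (∈-allFin (Inverse.to enumeration x)))

open FiniteSet using (Carrier)

update : ∀ {x} {I : Set} {X : I → Set x} → DecidableEquality I →
         (∀ i → X i) → ∀ i → X i → ∀ j → X j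
update _≟_ f i x j with i ≟ j
... | yes refl = x
... | no  _    = f j

ℤ₀ : Set
ℤ₀ = Refinement ℤ NonZero

-- Participants, messages and control points are distinct types, so the
-- pairwise disjointness of these sets needs no hypothesis.
record Vocabulary : Set₁ where
  field
    participants    : FiniteSet
    Message         : Set
    † ‡             : Message
    †≢‡             : † ≢ ‡
    PredicateSymbol : Set

module Syntax (V : Vocabulary) where
  open Vocabulary V public

  Participant : Set
  Participant = Carrier participants

  record Channel : Set where
    constructor _·_⟨_⟩
    field
      sender     : Participant
      receiver   : Participant
      .different : sender ≢ receiver

  open Channel public

  _≟ᶜ_ : DecidableEquality Channel
  (A · B ⟨ _ ⟩) ≟ᶜ (C · D ⟨ _ ⟩) =
    map′ (λ { (refl , refl) → refl }) (λ { refl → refl , refl })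
      ((A ≟ C) ×-dec (B ≟ D))
    where open FiniteSet participants using (_≟_)

  data Event : Set where
    _!⟨_⟩_ : Channel → ℤ₀ → Message → Event
    _?⟨_⟩_ : Channel → ℤ₀ → Message → Event

  sbj : Event → Participant
  sbj (c !⟨ _ ⟩ _) = sender c
  sbj (c ?⟨ _ ⟩ _) = receiver c

  data Guard : Set where
    pred   : PredicateSymbol → List Channel → Guard
    _isIn_ : Message → Channel → Guard
    not    : Guard → Guard
    _or_   : Guard → Guard → Guard

  _ChannelOf_ : Channel → Participant → Set
  c ChannelOf A = sender c ≡ A ⊎ receiver c ≡ A

  _PredicatesOnlyOnChannelsOf_ : Guard → Participant → Set
  pred _ cs  PredicatesOnlyOnChannelsOf A = All (_ChannelOf A) cs
  (_ isIn c) PredicatesOnlyOnChannelsOf A = c ChannelOf A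
  not φ      PredicatesOnlyOnChannelsOf A = φ PredicatesOnlyOnChannelsOf A
  (φ or ψ)   PredicatesOnlyOnChannelsOf A =
    φ PredicatesOnlyOnChannelsOf A × ψ PredicatesOnlyOnChannelsOf A

  record Label (Q : Set) : Set where
    constructor ⟨_∣_∣_⟩
    field
      state : Q
      event : Event
      guard : Guard

  -- The set {𝟏} ∪ L_Q ∪ L̄_Q.
  data Decoration (Q : Set) : Set where
    𝟏      : Decoration Q
    plain  : Label Q → Decoration Q
    marked : Label Q → Decoration Q

  mapLabel : {Q R : Set} → (Q → R) → Label Q → Label R
  mapLabel f ⟨ q ∣ e ∣ φ ⟩ = ⟨ f q ∣ e ∣ φ ⟩

  mapDecoration : {Q R : Set} → (Q → R) → Decoration Q → Decoration R
  mapDecoration f 𝟏          = 𝟏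
  mapDecoration f (plain l)  = plain (mapLabel f l)
  mapDecoration f (marked l) = marked (mapLabel f l)

  GuardOf_On_ : {Q : Set} → Decoration Q → Participant → Set
  GuardOf 𝟏        On A = ⊤
  GuardOf plain l  On A = Label.guard l PredicatesOnlyOnChannelsOf A
  GuardOf marked l On A = Label.guard l PredicatesOnlyOnChannelsOf A

  -- Finite transition relations are given by lists; only membership in
  -- them is ever used, and two machines are identified when their lists
  -- have the same members.
  record RCFSM (A : Participant) (Q : FiniteSet) : Set where
    field
      initial     : Carrier Q
      transitions : List (Carrier Q × Event × Decoration (Carrier Q) × Carrier Q)
      subject-ok  : ∀ {q e λ′ q′} → (q , e , λ′ , q′) ∈ transitions → sbj e ≡ A
      guard-ok    : ∀ {q e λ′ q′} → (q , e , λ′ , q′) ∈ transitions → GuardOf λ′ On A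

  Deterministic : ∀ {A Q} → RCFSM A Q → Set
  Deterministic M =
    ∀ {q e λ₁ λ₂ q₁ q₂} →
    (q , e , λ₁ , q₁) ∈ transitions → (q , e , λ₂ , q₂) ∈ transitions → q₁ ≡ q₂
    where open RCFSM M

  record CFSM (Q : FiniteSet) : Set where
    field
      initial     : Carrier Q
      transitions : List (Carrier Q × Event × Carrier Q)

  record _≐_ {Q : FiniteSet} (M N : CFSM Q) : Set where
    field
      initial     : CFSM.initial M ≡ CFSM.initial N
      transitions : CFSM.transitions M ∼[ set ] CFSM.transitions N

  forgetMachine : ∀ {A Q} → RCFSM A Q → CFSM Q
  forgetMachine M = record
    { initial     = RCFSM.initial M
    ; transitions = map (λ (q , e , _ , q′) → q , e , q′) (RCFSM.transitions M)
    }

-- Q A is the set of states of the machine of A, both in a reversible system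
-- and in the standard ones compared with it: S′ = forget(S) already forces
-- the state sets to agree.
module Semantics (V : Vocabulary)
                 (Q : Carrier (Vocabulary.participants V) → FiniteSet) where
  open Syntax V
  open FiniteSet participants using (_≟_; elements; ∈-elements)

  RSystem : Set
  RSystem = ∀ A → RCFSM A (Q A)

  System : Set
  System = ∀ A → CFSM (Q A)

  _≐ˢ_ : System → System → Set
  S ≐ˢ T = ∀ A → S A ≐ T A

  forgetSystem : RSystem → System
  forgetSystem S A = forgetMachine (S A)

  LocalStates : Set
  LocalStates = ∀ A → Carrier (Q A)

  _[_↦_] : LocalStates → ∀ A → Carrier (Q A) → LocalStates
  σ [ A ↦ q ] = update _≟_ σ A q

  _[_↦_]ᶜ : {X : Set} → (Channel → X) → Channel → X → Channel → X
  χ [ c ↦ x ]ᶜ = update _≟ᶜ_ χ c x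

  record Configuration : Set where
    constructor ⟨_∣_⟩
    field
      σ : LocalStates
      χ : Channel → List Message

  -- Equality of configurations, which are functions, is pointwise.
  record _≈_ (k k′ : Configuration) : Set where
    field
      σ : ∀ A → Configuration.σ k A ≡ Configuration.σ k′ A
      χ : ∀ c → Configuration.χ k c ≡ Configuration.χ k′ c

  initialOf : System → Configuration
  initialOf S = ⟨ (λ A → CFSM.initial (S A)) ∣ (λ _ → []) ⟩

  data _⊢_⟶_ (S : System) : Configuration → Configuration → Set where
    out : ∀ {σ χ c i m q} →
          (σ (sender c) , c !⟨ i ⟩ m , q) ∈ CFSM.transitions (S (sender c)) →
          S ⊢ ⟨ σ ∣ χ ⟩ ⟶ ⟨ σ [ sender c ↦ q ] ∣ χ [ c ↦ χ c ++ [ m ] ]ᶜ ⟩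
    inp : ∀ {σ χ c i m ms q} →
          (σ (receiver c) , c ?⟨ i ⟩ m , q) ∈ CFSM.transitions (S (receiver c)) →
          χ c ≡ m ∷ ms →
          S ⊢ ⟨ σ ∣ χ ⟩ ⟶ ⟨ σ [ receiver c ↦ q ] ∣ χ [ c ↦ ms ]ᶜ ⟩

  RC : System → Configuration → Set
  RC S = Star (S ⊢_⟶_) (initialOf S)

  -- The union of the sets Q A, which the tags make pairwise disjoint.
  𝒬 : Set
  𝒬 = Σ Participant (Carrier ∘ Q)

  _≟𝒬_ : DecidableEquality 𝒬
  _≟𝒬_ = ≡-dec _≟_ (λ {A} → FiniteSet._≟_ (Q A))

  record Log : Set where
    constructor log
    field
      message   : Message
      state     : 𝒬
      point     : ℤ₀
      timestamp : ℕ

  open Log using (message; timestamp)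

  _≺_ : Log → Log → Set
  ℓ ≺ ℓ′ = timestamp ℓ < timestamp ℓ′

  infix 3 _⨟_⟨_⟩

  record Content : Set where
    constructor _⨟_⟨_⟩
    field
      history     : List Log
      pending     : List Log
      .increasing : AllPairs _≺_ (history ++ pending)

    logs : List Log
    logs = history ++ pending

  open Content

  ε : Content
  ε = [] ⨟ [] ⟨ [] ⟩

  append : (u : Content) (ℓ : Log) → .(All (_≺ ℓ) (logs u)) → Content
  append (h ⨟ p ⟨ inc ⟩) ℓ ≺ℓ = h ⨟ p ++ [ ℓ ] ⟨
    subst (AllPairs _≺_) (++-assoc h p [ ℓ ])
      (AllPairs.++⁺ inc ([] ∷ []) (All.map (_∷ []) ≺ℓ)) ⟩

  consume : (u : Content) {ℓ : Log} {ℓs : List Log} → .(pending u ≡ ℓ ∷ ℓs) → Content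
  consume (h ⨟ p ⟨ inc ⟩) {ℓ} {ℓs} p≡ = h ++ [ ℓ ] ⨟ ℓs ⟨
    subst (AllPairs _≺_) (sym (++-assoc h [ ℓ ] ℓs))
      (subst (λ xs → AllPairs _≺_ (h ++ xs)) p≡ inc) ⟩

  channelBetween : Participant → Participant → Maybe Channel
  channelBetween A C with A ≟ C
  ... | yes _   = nothing
  ... | no  A≢C = just (A · C ⟨ A≢C ⟩)

  outgoing : Participant → List Channel
  outgoing A = mapMaybe (channelBetween A) elements

  outgoingTimestamps : (Channel → Content) → Participant → List ℕ
  outgoingTimestamps χ A = concatMap (map timestamp ∘ logs ∘ χ) (outgoing A)

  nextTimestamp : (Channel → Content) → Participant → ℕ
  nextTimestamp χ A = suc (max 0 (outgoingTimestamps χ A))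

  private
    ∈-outgoing : ∀ c → c ∈ outgoing (sender c)
    ∈-outgoing (A · B ⟨ A≢B ⟩) = go (∈-elements B)
      where
      go : ∀ {Bs} → B ∈ Bs → (A · B ⟨ A≢B ⟩) ∈ mapMaybe (channelBetween A) Bs
      go (here refl) with A ≟ B
      ... | yes A≡B = ⊥-elim-irr (A≢B A≡B)
      ... | no  _   = here refl
      go (there {x = C} B∈Bs) with channelBetween A C
      ... | just _  = there (go B∈Bs)
      ... | nothing = go B∈Bs

  ≺-next : ∀ χ c →
           All (λ ℓ → timestamp ℓ < nextTimestamp χ (sender c)) (logs (χ c))
  ≺-next χ c = All.tabulate λ ℓ∈ → s≤s
    (All.lookup (xs≤max 0 (outgoingTimestamps χ (sender c)))
      (∈-concatMap⁺ (map timestamp ∘ logs ∘ χ)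
        (Any.map (λ { refl → ∈-map⁺ timestamp ℓ∈ }) (∈-outgoing c))))

  Branches : Set₁
  Branches = 𝒬 → Pred (Event × Guard) 0ℓ × Bool

  reset : 𝒬 → Branches → Branches
  reset q β = update _≟𝒬_ β q (∅ , false)

  LabelValid : Label 𝒬 → Branches → Set
  LabelValid ⟨ q ∣ e ∣ φ ⟩ β = proj₁ (β q) (e , φ) → proj₂ (β q) ≡ true

  -- The graph of the partial map upd_O; undefined exactly on invalid decorations.
  data UpdO : Decoration 𝒬 → Branches → Branches → Set₁ where
    𝟏      : ∀ {β} → UpdO 𝟏 β β
    plain  : ∀ {l β} → LabelValid l β → UpdO (plain l) β β
    marked : ∀ {l β} → LabelValid l β → UpdO (marked l) β (reset (Label.state l) β)

  updI : Decoration 𝒬 → Branches → Branches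
  updI 𝟏          β = β
  updI (plain _)  β = β
  updI (marked l) β = reset (Label.state l) β

  record RConfiguration : Set₁ where
    constructor ⟨_∣_∣_⟩
    field
      σ : LocalStates
      χ : Channel → Content
      β : Branches

  initialOfᴿ : RSystem → RConfiguration
  initialOfᴿ S = ⟨ (λ A → RCFSM.initial (S A)) ∣ (λ _ → ε) ∣ (λ _ → ∅ , false) ⟩

  data _⊢_⟹_ (S : RSystem) : RConfiguration → RConfiguration → Set₁ where
    out : ∀ {σ χ β β′ c i m λ′ q} →
          let A = sender c
              ℓ = log m (A , σ A) i (nextTimestamp χ A)
          in
          (σ A , c !⟨ i ⟩ m , λ′ , q) ∈ RCFSM.transitions (S A) →
          UpdO (mapDecoration (A ,_) λ′) β β′ →
          S ⊢ ⟨ σ ∣ χ ∣ β ⟩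
            ⟹ ⟨ σ [ A ↦ q ] ∣ χ [ c ↦ append (χ c) ℓ (≺-next χ c) ]ᶜ ∣ β′ ⟩
    inp : ∀ {σ χ β c i m λ′ q ℓ ℓs} →
          let A = receiver c in
          (σ A , c ?⟨ i ⟩ m , λ′ , q) ∈ RCFSM.transitions (S A) →
          (p≡ : pending (χ c) ≡ ℓ ∷ ℓs) →
          message ℓ ≡ m →
          S ⊢ ⟨ σ ∣ χ ∣ β ⟩
            ⟹ ⟨ σ [ A ↦ q ] ∣ χ [ c ↦ consume (χ c) p≡ ]ᶜ
              ∣ updI (mapDecoration (A ,_) λ′) β ⟩

  RCᴿ : RSystem → RConfiguration → Set₁
  RCᴿ S = Star (S ⊢_⟹_) (initialOfᴿ S)

  forget : RConfiguration → Configuration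
  forget ⟨ σ ∣ χ ∣ _ ⟩ = ⟨ σ ∣ map message ∘ pending ∘ χ ⟩

{-# OPTIONS --safe #-}

-- No forward rule ever inserts a pair into the sets of β, so these sets stay
-- empty along every computation.  Hence every decoration is valid, upd_O is
-- always defined, and a step of forget(S) is matched by a step of S.
module Submission where

open import Defs
open import Data.List.Base using (List; _∷_; [_]; _++_; map)
open import Data.List.Membership.Propositional using (_∈_)
open import Data.List.Membership.Propositional.Properties using (∈-map⁻)
open import Data.List.Properties using (map-++; ∷-injective)
open import Data.Product using (Σ-syntax; ∃-syntax; _×_; _,_; proj₁)
open import Function.Bundles using (module Equivalence)
open import Relation.Binary.Construct.Closure.ReflexiveTransitive
  using (Star) renaming (ε to []⋆; _◅_ to _∷⋆_)
open import Relation.Binary.Definitions using (DecidableEquality)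
open import Relation.Binary.PropositionalEquality
  using (_≡_; refl; sym; trans; cong; subst)
open import Relation.Nullary using (yes; no; contradiction)
open import Relation.Unary using (Empty)

-- Both updates branch on the same decision `i ≟ j`. The relation `R` is heterogeneous so that one
-- lemma serves local states, compared by equality, and channels, where a content with logs is
-- compared with a list of messages.
update-cong : ∀ {x y r} {I : Set} {X : I → Set x} {Y : I → Set y}
              (_≟_ : DecidableEquality I) (R : ∀ {i} → X i → Y i → Set r) →
              {f : ∀ i → X i} {g : ∀ i → Y i} → (∀ i → R (f i) (g i)) →
              ∀ i {x : X i} {y : Y i} → R x y →
              ∀ j → R (update _≟_ f i x j) (update _≟_ g i y j)
update-cong _≟_ R fRg i xRy j with i ≟ j
... | yes refl = xRy
... | no  _    = fRg j

map≡∷ : {A B : Set} (f : A → B) {xs : List A} {y : B} {ys : List B} →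
        map f xs ≡ y ∷ ys →
        ∃[ x ] ∃[ xs′ ] xs ≡ x ∷ xs′ × f x ≡ y × map f xs′ ≡ ys
map≡∷ f {x ∷ xs} eq = x , xs , refl , ∷-injective eq

module Simulation (V : Vocabulary) (Q : Syntax.Participant V → FiniteSet) where
  open Syntax V
  open Semantics V Q
  open FiniteSet participants using () renaming (_≟_ to _≟ₚ_)
  open Log using (message)
  open Content using (pending)

  -- The invariant of the simulation. It leaves the boolean component free: `LabelValid` is an
  -- implication from membership, so emptiness alone makes it vacuous.
  NoBranches : Branches → Set
  NoBranches β = ∀ q → Empty (proj₁ (β q))

  reset-noBranches : ∀ q {β} → NoBranches β → NoBranches (reset q β)
  reset-noBranches q none q′ with q ≟𝒬 q′
  ... | yes refl = λ _ ()
  ... | no  _    = none q′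

  updO-defined : ∀ d {β} → NoBranches β → ∃[ β′ ] UpdO d β β′ × NoBranches β′
  updO-defined 𝟏          none = _ , 𝟏 , none
  updO-defined (plain l)  none =
    _ , plain (λ l∈ → contradiction l∈ (none _ _)) , none
  updO-defined (marked l) none =
    _ , marked (λ l∈ → contradiction l∈ (none _ _)) , reset-noBranches _ none

  updI-noBranches : ∀ d {β} → NoBranches β → NoBranches (updI d β)
  updI-noBranches 𝟏          none = none
  updI-noBranches (plain _)  none = none
  updI-noBranches (marked _) none = reset-noBranches _ none

  module _ {S : RSystem} {S′ : System} (S′≐ : S′ ≐ˢ forgetSystem S) where

    -- Membership in the image of the forgetful map yields a preimage. Any preimage will do, since
    -- under `NoBranches` no decoration can block a step.
    decorate : ∀ {A q e q′} → (q , e , q′) ∈ CFSM.transitions (S′ A) →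
               ∃[ d ] (q , e , d , q′) ∈ RCFSM.transitions (S A)
    decorate {A} t∈
      with ∈-map⁻ _ (Equivalence.to (_≐_.transitions (S′≐ A)) t∈)
    ... | (_ , _ , d , _) , t∈S , refl = d , t∈S

    -- `κ` is tied to `k` only through `≈`, configurations being functions; its histories and
    -- time-stamps remain arbitrary.
    step : ∀ {κ k k₁} → S′ ⊢ k ⟶ k₁ →
           forget κ ≈ k → NoBranches (RConfiguration.β κ) →
           ∃[ κ₁ ] (S ⊢ κ ⟹ κ₁) × forget κ₁ ≈ k₁ × NoBranches (RConfiguration.β κ₁)
    step {κ} (out {c = c} {m = m} t∈) κ≈k none
      with d , t∈S ← decorate (subst (λ q → (q , _) ∈ _) (sym (_≈_.σ κ≈k (sender c))) t∈)
      with _ , upd , none′ ← updO-defined (mapDecoration (sender c ,_) d) none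
      = _ , out t∈S upd , record
        { σ = update-cong _≟ₚ_ _≡_ (_≈_.σ κ≈k) (sender c) refl
        ; χ = update-cong _≟ᶜ_ (λ u ms → map message (pending u) ≡ ms) (_≈_.χ κ≈k) c
                -- The new log joins the end of the pending part, so forgetting it appends exactly
                -- `m`.
                (trans (map-++ message (pending (RConfiguration.χ κ c)) _)
                       (cong (_++ [ m ]) (_≈_.χ κ≈k c)))
        } , none′
    step (inp {c = c} t∈ χc≡) κ≈k none
      with d , t∈S ← decorate (subst (λ q → (q , _) ∈ _) (sym (_≈_.σ κ≈k (receiver c))) t∈)
      -- Forgetting acts log by log on the pending part, so a queue headed by the expected message
      -- comes from a pending part whose first log carries it.
      with _ , _ , p≡ , ℓ≡m , ℓs≡ms ← map≡∷ message (trans (_≈_.χ κ≈k c) χc≡)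
      = _ , inp t∈S p≡ ℓ≡m , record
        { σ = update-cong _≟ₚ_ _≡_ (_≈_.σ κ≈k) (receiver c) refl
        ; χ = update-cong _≟ᶜ_ (λ u ms → map message (pending u) ≡ ms) (_≈_.χ κ≈k) c ℓs≡ms
        } , updI-noBranches (mapDecoration (receiver c ,_) d) none

    -- `Star` is consumed from the front, so the induction needs an arbitrary related pair as its
    -- starting point.
    steps : ∀ {κ k k₁} → Star (S′ ⊢_⟶_) k k₁ →
            forget κ ≈ k → NoBranches (RConfiguration.β κ) →
            ∃[ κ₁ ] Star (S ⊢_⟹_) κ κ₁ × forget κ₁ ≈ k₁
    steps []⋆         κ≈k none = _ , []⋆ , κ≈k
    steps (s ∷⋆ rest) κ≈k none
      with _  , s′ , κ₁≈ , none₁ ← step s κ≈k none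
      with κ₂ , rest′ , κ₂≈ ← steps rest κ₁≈ none₁
      = κ₂ , s′ ∷⋆ rest′ , κ₂≈

theorem2 : (V : Vocabulary) (let open Syntax V) (Q : Participant → FiniteSet) →
    let open Semantics V Q in
    (S : RSystem) → (∀ A → Deterministic (S A)) →
    (S′ : System) → S′ ≐ˢ forgetSystem S →
    (k : Configuration) → RC S′ k →
    Σ[ k′ ∈ RConfiguration ] (RCᴿ S k′ × forget k′ ≈ k)
theorem2 V Q S _ S′ S′≐ k reach =
  steps S′≐ reach
    -- The initial configurations are related: the initial states agree by `S′≐` and all channels
    -- are empty.
    (record { σ = λ A → sym (_≐_.initial (S′≐ A)) ; χ = λ _ → refl })
    (λ _ _ ())
  where
  open Syntax V
  open Simulation V Q
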